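{- Let $p$ be a prime and let $a,b\geq 1$ be integers. The $p$-adic valuation of the total number, over all sizes $n\ge 0$, of partitions having pairing index $a$ and pairing width $b$ equals the number of carries that occur when $a-1$ and $b-1$ are added in base $p$.
   Context: For an integer partition $\lambda$, pair equal parts of $\lambda$ as far as possible: for each part size occurring with odd multiplicity exactly one copy remains unpaired, and a part size of even multiplicity is completely paired. Let $r(\lambda)$ be the largest part size that participates in at least one pair (i.e. of multiplicity at least $2$), with $r(\lambda)=0$ if $\lambda$ has distinct parts. Write the unpaired parts (the part sizes of odd multiplicity, each once) in decreasing order $u_1>u_2>\cdots>u_j$ and let $s(\lambda)=u_1-u_2+u_3-u_4+\cdots$ (so $s(\lambda)=0$ if there are no unpaired parts). The pairing index of $\lambda$ is $T(\lambda)=r(\lambda)+s(\lambda)$. The pair span of $\lambda$ is the number of parts of $\lambda$ (counted with multiplicity) that belong to pairs. The residual span of $\lambda$ is $2\bigl(u_1-s(\lambda)\bigr)+1$ if there is at least one unpaired part, and $0$ if there are no unpaired parts. The pairing width $W(\lambda)$ is the larger of the pair span and the residual span. -}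

module Defs where

open import Data.Fin.Base using (Fin)
open import Data.List.Base
  using (List; []; _∷_; length; filter; map; deduplicate; upTo)
open import Data.List.Extrema using (max)
open import Data.List.Relation.Unary.All using (All)
open import Data.List.Relation.Unary.Linked using (Linked)
open import Data.Nat.Base
  using (ℕ; zero; suc; _+_; _∸_; _*_; _^_; _/_; _%_; _⊔_; _≥_; NonZero)
open import Data.Nat.Divisibility using (_∣_)
open import Data.Nat.ListAction using (sum)
open import Data.Nat.Properties using (_≟_; _≤?_; ≤-totalOrder; m^n≢0)
open import Data.Product.Base using (Σ; _×_)
open import Function.Bundles using (_↔_)
open import Relation.Binary.PropositionalEquality.Core using (_≡_)
open import Relation.Nullary.Negation using (¬_)

-- A partition of some n ≥ 0; its size n is `sum parts`.  The proof fields are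
-- irrelevant, so partitions are equal exactly when their lists of parts are.
record Partition : Set where
  constructor mkPartition
  field
    parts       : List ℕ
    .decreasing : Linked _≥_ parts
    .positive   : All NonZero parts

open Partition public

multiplicity : Partition → ℕ → ℕ
multiplicity π i = length (filter (i ≟_) (parts π))

-- `deduplicate` keeps first occurrences in order, so the sizes (and hence the
-- unpaired parts below) are listed in strictly decreasing order.
partSizes : Partition → List ℕ
partSizes π = deduplicate _≟_ (parts π)

pairedSizes : Partition → List ℕ
pairedSizes π = filter (λ i → 2 ≤? multiplicity π i) (partSizes π)

unpaired : Partition → List ℕ
unpaired π = filter (λ i → multiplicity π i % 2 ≟ 1) (partSizes π)

r : Partition → ℕ
r π = max ≤-totalOrder 0 (pairedSizes π)

-- u₁ ∸ (u₂ ∸ (u₃ ∸ ⋯)).  On a decreasing list every alternating sum of a tail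
-- is at most the head of that tail, so the subtraction never truncates and this
-- is u₁ - u₂ + u₃ - ⋯.
alternatingSum : List ℕ → ℕ
alternatingSum []       = 0
alternatingSum (u ∷ us) = u ∸ alternatingSum us

s : Partition → ℕ
s π = alternatingSum (unpaired π)

pairingIndex : Partition → ℕ
pairingIndex π = r π + s π

-- A part size of multiplicity m contributes ⌊m/2⌋ pairs.
pairSpan : Partition → ℕ
pairSpan π = sum (map (λ i → 2 * (multiplicity π i / 2)) (partSizes π))

-- Again u₁ ∸ alternatingSum (u₁ ∷ us) does not truncate.
residualSpanOf : List ℕ → ℕ
residualSpanOf []          = 0
residualSpanOf us@(u₁ ∷ _) = 2 * (u₁ ∸ alternatingSum us) + 1

residualSpan : Partition → ℕ
residualSpan π = residualSpanOf (unpaired π)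

pairingWidth : Partition → ℕ
pairingWidth π = pairSpan π ⊔ residualSpan π

-- The partitions, of all sizes together, with pairing index a and pairing
-- width b are finite in number, and there are N of them.
TotalNumber : ℕ → ℕ → ℕ → Set
TotalNumber a b N =
  Fin N ↔ Σ Partition λ π → pairingIndex π ≡ a × pairingWidth π ≡ b

-- The p-adic valuation of N is k.  For N = 0 this holds for no k, as it should:
-- the valuation is then infinite.
Valuation : ℕ → ℕ → ℕ → Set
Valuation p N k = (p ^ k) ∣ N × ¬ ((p ^ suc k) ∣ N)

module _ (p : ℕ) .{{_ : NonZero p}} where

  digit : ℕ → ℕ → ℕ
  digit x i = (_/_ x (p ^ i) {{m^n≢0 p i}}) % p

  -- The carry into position i when x and y are added in base p; it is 0 or 1
  -- when p ≥ 2.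
  carryInto : ℕ → ℕ → ℕ → ℕ
  carryInto x y zero    = 0
  carryInto x y (suc i) = (digit x i + digit y i + carryInto x y i) / p

  -- The carry out of position i is counted at i.  A carry there forces
  -- x + y ≥ p ^ suc i > i (for p ≥ 2), so positions i < x + y account for all
  -- carries.
  numberOfCarries : ℕ → ℕ → ℕ
  numberOfCarries x y = sum (map (λ i → carryInto x y (suc i)) (upTo (x + y)))

{-# OPTIONS --safe #-}

-- Treat the pairs and the unpaired parts of a partition separately.  The boundary
-- path of the pairs is a word with r letters true (raise the part size) and one
-- letter false for each pair.  The unpaired parts are given by the word whose i-th
-- letter says whether the number of unpaired parts ≥ i is odd; it has s letters true
-- and u₁ - s letters false.  Padding the word with fewer letters false and gluing the
-- two together is a bijection from the partitions with pairing index a and pairing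
-- width b onto the words with a - 1 letters true and b - 1 letters false.  So their
-- number is (a + b - 2) C (a - 1), and Kummer's theorem gives its valuation.  The
-- latter follows from n! = p ^ ⌊n / p⌋ · ⌊n / p⌋! · u with u prime to p, applied
-- digit by digit.

module Submission where

open import Defs
open import Data.Bool.Base using (Bool; true; false; not; _xor_)
open import Data.Bool.Properties using (not-involutive)
open import Data.Fin.Base using (Fin; zero; suc)
open import Data.Fin.Properties using (+↔⊎)
open import Data.List.Base
  using (List; []; _∷_; _++_; _∷ʳ_; replicate; map; foldr; filter; length; deduplicate; applyUpTo; upTo)
open import Data.List.Properties
  using (filter-++; filter-none; filter-accept; filter-reject; length-++; map-++; upTo-∷ʳ)
open import Data.List.Relation.Unary.All as All using (All; []; _∷_)
import Data.List.Relation.Unary.All.Properties as All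
open import Data.List.Relation.Unary.AllPairs as AllPairs using (AllPairs; []; _∷_)
import Data.List.Relation.Unary.AllPairs.Properties as AllPairs
open import Data.List.Relation.Unary.Any using (here)
open import Data.List.Relation.Unary.Linked using (linked?)
open import Data.List.Relation.Unary.Linked.Properties using (AllPairs⇒Linked; Linked⇒AllPairs)
open import Data.Maybe.Base using (Maybe; just; nothing)
open import Data.Nat.Base
open import Data.Nat.Combinatorics
  using (_C_; nCn≡1; nCk+nC[k+1]≡[n+1]C[k+1]; nCk≡n!/k![n-k]!; k![n∸k]!∣n!)
open import Data.Nat.Divisibility
open import Data.Nat.DivMod
open import Data.Nat.ListAction using (sum)
open import Data.Nat.ListAction.Properties using (sum-++)
open import Data.Nat.Primality using (Prime; prime⇒nonZero; prime⇒nonTrivial; euclidsLemma)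
open import Data.Nat.Properties
open import Data.Nat.Tactic.RingSolver using (solve-∀)
open import Data.List.Extrema ≤-totalOrder using (max; max≈v⁺)
open import Data.Product.Base using (Σ; ∃-syntax; _×_; _,_; proj₁; proj₂)
open import Data.Sum.Base using (_⊎_; inj₁; inj₂; [_,_]′)
open import Data.Sum.Function.Propositional using (_⊎-↔_)
open import Data.Unit.Base using (⊤; tt)
open import Function.Base using (_∘_; flip)
open import Function.Bundles using (_↔_; mk↔ₛ′)
open import Function.Properties.Inverse using (↔-sym; ↔-trans)
open import Level using (0ℓ)
open import Relation.Binary.PropositionalEquality
open import Relation.Nullary.Decidable using (does; yes; no; ¬?; recompute; dec-false)
open import Relation.Nullary.Negation using (¬_; contradiction)
open import Relation.Unary using (Pred; Decidable)

-- Kummer's theorem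

module Kummer (p : ℕ) (p-prime : Prime p) where

  private instance
    p≢0 : NonZero p
    p≢0 = prime⇒nonZero p-prime
    p>1 : NonTrivial p
    p>1 = prime⇒nonTrivial p-prime

  infix 4 _~_

  -- Equality up to factors prime to p.
  data _~_ (m n : ℕ) : Set where
    up-to : ∀ u v → p ∤ u → p ∤ v → m * u ≡ n * v → m ~ n

  p∤1 : p ∤ 1
  p∤1 = >⇒∤ (nonTrivial⇒n>1 p)

  ∤-* : ∀ {u v} → p ∤ u → p ∤ v → p ∤ u * v
  ∤-* p∤u p∤v p∣uv = [ p∤u , p∤v ]′ (euclidsLemma _ _ p-prime p∣uv)

  ~-reflexive : ∀ {m n} → m ≡ n → m ~ n
  ~-reflexive refl = up-to 1 1 p∤1 p∤1 refl

  ~-sym : ∀ {m n} → m ~ n → n ~ m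
  ~-sym (up-to u v p∤u p∤v eq) = up-to v u p∤v p∤u (sym eq)

  ~-trans : ∀ {l m n} → l ~ m → m ~ n → l ~ n
  ~-trans {l} {m} {n} (up-to u v p∤u p∤v eq) (up-to u′ v′ p∤u′ p∤v′ eq′) =
    up-to (u * u′) (v * v′) (∤-* p∤u p∤u′) (∤-* p∤v p∤v′) (begin
      l * (u * u′)  ≡⟨ *-assoc l u u′ ⟨
      l * u * u′    ≡⟨ cong (_* u′) eq ⟩
      m * v * u′    ≡⟨ swap m v u′ ⟩
      m * u′ * v    ≡⟨ cong (_* v) eq′ ⟩
      n * v′ * v    ≡⟨ swap n v′ v ⟩
      n * v * v′    ≡⟨ *-assoc n v v′ ⟩
      n * (v * v′)  ∎)
    where
    open ≡-Reasoning
    swap : ∀ a b c → a * b * c ≡ a * c * b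
    swap = solve-∀

  ~-* : ∀ {k l m n} → k ~ l → m ~ n → k * m ~ l * n
  ~-* {k} {l} {m} {n} (up-to u v p∤u p∤v eq) (up-to u′ v′ p∤u′ p∤v′ eq′) =
    up-to (u * u′) (v * v′) (∤-* p∤u p∤u′) (∤-* p∤v p∤v′)
    (trans (interchange k m u u′) (trans (cong₂ _*_ eq eq′) (interchange l v n v′)))
    where
    interchange : ∀ a b c d → a * b * (c * d) ≡ a * c * (b * d)
    interchange = solve-∀

  ~-cancelˡ : ∀ k {m n} .{{_ : NonZero k}} → k * m ~ k * n → m ~ n
  ~-cancelˡ k {m} {n} (up-to u v p∤u p∤v eq) = up-to u v p∤u p∤v
    (*-cancelˡ-≡ (m * u) (n * v) k (trans (sym (*-assoc k m u)) (trans eq (*-assoc k n v))))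

  ∤⇒~1 : ∀ {u} → p ∤ u → u ~ 1
  ∤⇒~1 {u} p∤u = up-to 1 u p∤1 p∤u (*-comm u 1)

  -- Euclid's lemma puts one factor `p` into `m`, as `u` has none. Cancelling it on both sides
  -- leaves the same claim for the exponent `k`.
  ∣-cancelʳ-^ : ∀ k m {u} → p ∤ u → p ^ k ∣ m * u → p ^ k ∣ m
  ∣-cancelʳ-^ zero    m       p∤u _ = 1∣ m
  ∣-cancelʳ-^ (suc k) m {u} p∤u p^1+k∣mu
    with euclidsLemma m u p-prime (∣-trans (m∣m*n (p ^ k)) p^1+k∣mu)
  ... | inj₂ p∣u = contradiction p∣u p∤u
  ... | inj₁ (divides-refl q) =
    subst (p ^ suc k ∣_) (*-comm p q) (*-monoʳ-∣ p (∣-cancelʳ-^ k q p∤u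
      (*-cancelˡ-∣ p (subst (p ^ suc k ∣_) (rearrange q p u) p^1+k∣mu))))
    where
    rearrange : ∀ a b c → a * b * c ≡ b * (a * c)
    rearrange = solve-∀

  -- From `n * u ≡ p ^ k * v`: the power `p ^ k` divides `n * u`, hence `n`; one more factor `p` in
  -- `n` would have to divide `v`.
  ~⇒Valuation : ∀ {n} k → n ~ p ^ k → Valuation p n k
  ~⇒Valuation {n} k (up-to u v p∤u p∤v eq) =
    ∣-cancelʳ-^ k n p∤u (subst (p ^ k ∣_) (sym eq) (m∣m*n v)) ,
    λ p^1+k∣n → p∤v (*-cancelˡ-∣ (p ^ k) {{m^n≢0 p k}}
      (subst₂ _∣_ (*-comm p (p ^ k)) eq (∣-trans p^1+k∣n (m∣m*n u))))

  -- The extra factors lie strictly between the multiples `q * p` and `suc q * p` of `p`, so they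
  -- are prime to `p`.
  [qp+r]!~[qp]! : ∀ q r → r < p → (r + q * p) ! ~ (q * p) !
  [qp+r]!~[qp]! q zero    _     = ~-reflexive refl
  [qp+r]!~[qp]! q (suc r) 1+r<p =
    ~-trans (~-* (∤⇒~1 p∤) ([qp+r]!~[qp]! q r (<-trans (n<1+n r) 1+r<p)))
            (~-reflexive (*-identityˡ _))
    where
    p∤ : p ∤ suc (r + q * p)
    p∤ p∣ = >⇒∤ 1+r<p (∣m+n∣n⇒∣m p∣ (n∣m*n q))
      where
      ∣m+n∣n⇒∣m : p ∣ suc r + q * p → p ∣ q * p → p ∣ suc r
      ∣m+n∣n⇒∣m h = ∣m+n∣m⇒∣n (subst (p ∣_) (+-comm (suc r) (q * p)) h)

  [qp]!~p^q*q! : ∀ q → (q * p) ! ~ p ^ q * q !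
  [qp]!~p^q*q! zero    = ~-reflexive refl
  [qp]!~p^q*q! (suc q) =
    -- Writing `p` as `suc (pred p)` lets the factorial unfold and expose its only new multiple of
    -- `p`, the top factor `p + q * p`. The `pred p` factors below it are removed by the previous
    -- lemma.
    ~-trans (~-reflexive (cong (λ x → (x + q * p) !) (sym (suc-pred p))))
    (~-trans (~-* (~-reflexive {m = suc (pred p) + q * p} (cong (_+ q * p) (suc-pred p)))
                  (~-trans ([qp+r]!~[qp]! q (pred p) pred[n]<n) ([qp]!~p^q*q! q)))
             (~-reflexive (rearrange p q (p ^ q) (q !))))
    where
    rearrange : ∀ a b c d → (a + b * a) * (c * d) ≡ a * c * (d + b * d)
    rearrange = solve-∀
    pred[n]<n : pred p < p
    pred[n]<n = subst (pred p <_) (suc-pred p) (n<1+n (pred p))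

  n!~p^[n/p]*[n/p]! : ∀ n → n ! ~ p ^ (n / p) * (n / p) !
  n!~p^[n/p]*[n/p]! n = ~-trans (~-reflexive (cong _! (m≡m%n+[m/n]*n n p)))
    (~-trans ([qp+r]!~[qp]! (n / p) (n % p) (m%n<n n p)) ([qp]!~p^q*q! (n / p)))

  -- Addition with carry at the lowest digit: `c` comes in, and the last quotient is carried out.
  [x+y+c]/p : ∀ x y c → (x + y + c) / p ≡ x / p + y / p + (x % p + y % p + c) / p
  [x+y+c]/p x y c = begin
    (x + y + c) / p
      ≡⟨ cong₂ (λ a b → (a + b + c) / p) (m≡m%n+[m/n]*n x p) (m≡m%n+[m/n]*n y p) ⟩
    (x % p + x / p * p + (y % p + y / p * p) + c) / p
      ≡⟨ cong (_/ p) (rearrange (x % p) (x / p) (y % p) (y / p) c p) ⟩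
    ((x / p + y / p) * p + (x % p + y % p + c)) / p
      ≡⟨ +-distrib-/-∣ˡ _ (n∣m*n (x / p + y / p)) ⟩
    (x / p + y / p) * p / p + (x % p + y % p + c) / p
      ≡⟨ cong (_+ (x % p + y % p + c) / p) (m*n/n≡m (x / p + y / p) p) ⟩
    x / p + y / p + (x % p + y % p + c) / p ∎
    where
    open ≡-Reasoning
    rearrange : ∀ a a′ b b′ c p → a + a′ * p + (b + b′ * p) + c ≡ (a′ + b′) * p + (a + b + c)
    rearrange = solve-∀

  -- Legendre's step `n ! ~ p ^ (n / p) * (n / p) !`, taken for `x + y + c`, `x` and `y`: the
  -- exponent of the first exceeds the sum of the other two by the carry. Everything is multiplied
  -- out to avoid quotients of factorials.
  carry-step : ∀ x y c → let c′ = (x % p + y % p + c) / p in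
    (x + y + c) ! * ((x / p) ! * (y / p) !) ~
    p ^ c′ * (x ! * y !) * (x / p + y / p + c′) !
  carry-step x y c = ~-trans
    (~-* (~-trans (n!~p^[n/p]*[n/p]! (x + y + c))
                  (~-reflexive (cong (λ k → p ^ k * k !) ([x+y+c]/p x y c))))
         (~-reflexive refl))
    (~-trans (~-reflexive (begin
        p ^ (x′ + y′ + c′) * z * (x′ ! * y′ !)
          ≡⟨ cong (λ k → k * z * (x′ ! * y′ !))
               (trans (^-distribˡ-+-* p (x′ + y′) c′) (cong (_* p ^ c′) (^-distribˡ-+-* p x′ y′))) ⟩
        p ^ x′ * p ^ y′ * p ^ c′ * z * (x′ ! * y′ !)
          ≡⟨ rearrange (p ^ x′) (p ^ y′) (p ^ c′) z (x′ !) (y′ !) ⟩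
        p ^ c′ * (p ^ x′ * x′ ! * (p ^ y′ * y′ !)) * z ∎))
      (~-* (~-* (~-reflexive {m = p ^ c′} refl)
                (~-* (~-sym (n!~p^[n/p]*[n/p]! x)) (~-sym (n!~p^[n/p]*[n/p]! y))))
           (~-reflexive refl)))
    where
    open ≡-Reasoning
    x′ = x / p
    y′ = y / p
    c′ = (x % p + y % p + c) / p
    z = (x′ + y′ + c′) !
    rearrange : ∀ a b c z d e → a * b * c * z * (d * e) ≡ c * (a * d * (b * e)) * z
    rearrange = solve-∀

  private
    infixl 7 _/p^_

    _/p^_ : ℕ → ℕ → ℕ
    x /p^ i = _/_ x (p ^ i) {{m^n≢0 p i}}

    carry : ℕ → ℕ → ℕ → ℕ
    carry = carryInto p

  /p^-suc : ∀ x i → x /p^ suc i ≡ (x /p^ i) / p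
  /p^-suc x i = trans (/-congʳ {{m^n≢0 p (suc i)}} {{m*n≢0 (p ^ i) p}} (*-comm p (p ^ i)))
                      (sym (m/n/o≡m/[n*o] x (p ^ i) p))
    where instance
    p^i≢0 = m^n≢0 p i
    p^i*p≢0 = m*n≢0 (p ^ i) p

  sum-carries-suc : ∀ x y n → sum (map (λ i → carry x y (suc i)) (upTo (suc n))) ≡
                    sum (map (λ i → carry x y (suc i)) (upTo n)) + carry x y (suc n)
  sum-carries-suc x y n = begin
    sum (map f (upTo (suc n)))       ≡⟨ cong (sum ∘ map f) (upTo-∷ʳ n) ⟨
    sum (map f (upTo n ∷ʳ n))        ≡⟨ cong sum (map-++ f (upTo n) (n ∷ [])) ⟩
    sum (map f (upTo n) ∷ʳ f n)      ≡⟨ sum-++ (map f (upTo n)) (f n ∷ []) ⟩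
    sum (map f (upTo n)) + (f n + 0) ≡⟨ cong (sum (map f (upTo n)) +_) (+-identityʳ (f n)) ⟩
    sum (map f (upTo n)) + f n       ∎
    where
    open ≡-Reasoning
    f = λ i → carry x y (suc i)

  -- `carry-step` telescoped over the lowest `n` digits: the quotients and the carry that one step
  -- produces are the input of the next.
  carries-upTo : ∀ x y n →
    (x + y) ! * ((x /p^ n) ! * (y /p^ n) !) ~
    p ^ sum (map (λ i → carry x y (suc i)) (upTo n)) * (x ! * y !)
      * (x /p^ n + y /p^ n + carry x y n) !
  carries-upTo x y zero
    rewrite n/1≡n x | n/1≡n y | +-identityʳ (x + y) = ~-reflexive (rearrange ((x + y) !) (x ! * y !))
    where
    rearrange : ∀ a b → a * b ≡ 1 * b * a
    rearrange = solve-∀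
  carries-upTo x y (suc n)
    rewrite sum-carries-suc x y n | /p^-suc x n | /p^-suc y n = ~-cancelˡ k
      -- Multiplying the induction hypothesis by the carry step puts `k`, the intermediate
      -- factorials, on both sides.
      (~-trans (~-reflexive (rearrangeˡ ((x + y) !) (X ! * Y !) z ((X / p) ! * (Y / p) !)))
      (~-trans (~-* (carries-upTo x y n) (carry-step X Y (carry x y n)))
      (~-reflexive (trans
        (rearrangeʳ (p ^ S) (x ! * y !) z (p ^ c′) (X ! * Y !) _)
        (cong (λ h → k * (h * (x ! * y !) * (X / p + Y / p + c′) !))
              (sym (^-distribˡ-+-* p S c′)))))))
    where
    X = x /p^ n
    Y = y /p^ n
    z = (X + Y + carry x y n) !
    c′ = carry x y (suc n)
    S = sum (map (λ i → carry x y (suc i)) (upTo n))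
    k = X ! * Y ! * z
    instance
      k≢0 : NonZero k
      k≢0 = m*n≢0 _ _ {{X !* Y !≢0}} {{(X + Y + carry x y n) !≢0}}
    rearrangeˡ : ∀ a b c d → b * c * (a * d) ≡ a * b * (c * d)
    rearrangeˡ = solve-∀
    rearrangeʳ : ∀ a b c d e f → a * b * c * (d * e * f) ≡ e * c * (a * d * b * f)
    rearrangeʳ = solve-∀

  carry≤1 : ∀ x y n → carry x y n ≤ 1
  carry≤1 x y zero    = z≤n
  carry≤1 x y (suc n) = s≤s⁻¹ (m<n*o⇒m/o<n (begin-strict
    digit p x n + digit p y n + carry x y n
      <⟨ +-mono-<-≤ (+-mono-<-≤ (m%n<n _ p) (<⇒≤pred (m%n<n _ p))) (carry≤1 x y n) ⟩
    p + pred p + 1    ≡⟨ +-assoc p (pred p) 1 ⟩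
    p + (pred p + 1)  ≡⟨ cong (p +_) (trans (+-comm (pred p) 1) (suc-pred p)) ⟩
    p + p             ≡⟨ cong (p +_) (+-identityʳ p) ⟨
    2 * p             ∎))
    where open ≤-Reasoning

  n<p^n : ∀ n → n < p ^ n
  n<p^n zero    = s≤s z≤n
  n<p^n (suc n) = begin-strict
    suc n            ≤⟨ n<p^n n ⟩
    p ^ n            <⟨ ^-monoʳ-< p (nonTrivial⇒n>1 p) (n<1+n n) ⟩
    p ^ suc n        ∎
    where open ≤-Reasoning

  /p^-vanish : ∀ {x} n → x ≤ n → x /p^ n ≡ 0
  /p^-vanish {x} n x≤n = m<n⇒m/n≡0 {{m^n≢0 p n}} (≤-<-trans x≤n (n<p^n n))

  n≤1⇒n!≡1 : ∀ {n} → n ≤ 1 → n ! ≡ 1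
  n≤1⇒n!≡1 z≤n       = refl
  n≤1⇒n!≡1 (s≤s z≤n) = refl

  -- After `x + y` digits both quotients are 0 because `n < p ^ n`. What remains is the factorial of
  -- a carry, which is 1.
  [x+y]!~p^carries*x!*y! : ∀ x y → (x + y) ! ~ p ^ numberOfCarries p x y * (x ! * y !)
  [x+y]!~p^carries*x!*y! x y with carries-upTo x y (x + y)
  ... | h rewrite /p^-vanish (x + y) (m≤m+n x y) | /p^-vanish (x + y) (m≤n+m y x)
                | n≤1⇒n!≡1 (carry≤1 x y (x + y)) =
    subst₂ _~_ (*-identityʳ _) (*-identityʳ _) h

  [x+y]Cx*x!*y! : ∀ x y → ((x + y) C x) * (x ! * y !) ≡ (x + y) !
  [x+y]Cx*x!*y! x y = begin
    ((x + y) C x) * (x ! * y !)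
      ≡⟨ cong (λ k → ((x + y) C x) * (x ! * k !)) (m+n∸m≡n x y) ⟨
    ((x + y) C x) * (x ! * (x + y ∸ x) !)
      ≡⟨ cong (_* (x ! * (x + y ∸ x) !)) (nCk≡n!/k![n-k]! (m≤m+n x y)) ⟩
    (x + y) ! / (x ! * (x + y ∸ x) !) * (x ! * (x + y ∸ x) !)
      ≡⟨ m/n*n≡m (k![n∸k]!∣n! (m≤m+n x y)) ⟩
    (x + y) ! ∎
    where
    open ≡-Reasoning
    instance _ = x !* (x + y ∸ x) !≢0

  kummer : ∀ x y → Valuation p ((x + y) C x) (numberOfCarries p x y)
  kummer x y = ~⇒Valuation (numberOfCarries p x y) (~-cancelˡ (x ! * y !) {{x !* y !≢0}}
    (subst₂ _~_ (trans (sym ([x+y]Cx*x!*y! x y)) (*-comm _ (x ! * y !)))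
                (*-comm (p ^ numberOfCarries p x y) (x ! * y !))
      ([x+y]!~p^carries*x!*y! x y)))

-- Words in two letters

Word : Set
Word = List Bool

trues falses : Word → ℕ
trues []          = 0
trues (true ∷ w)  = suc (trues w)
trues (false ∷ w) = trues w
falses []          = 0
falses (true ∷ w)  = falses w
falses (false ∷ w) = suc (falses w)

trues-++ : ∀ v w → trues (v ++ w) ≡ trues v + trues w
trues-++ []          w = refl
trues-++ (true ∷ v)  w = cong suc (trues-++ v w)
trues-++ (false ∷ v) w = trues-++ v w

falses-++ : ∀ v w → falses (v ++ w) ≡ falses v + falses w
falses-++ []          w = refl
falses-++ (true ∷ v)  w = falses-++ v w
falses-++ (false ∷ v) w = cong suc (falses-++ v w)

trues-falsesOnly : ∀ n → trues (replicate n false) ≡ 0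
trues-falsesOnly zero    = refl
trues-falsesOnly (suc n) = trues-falsesOnly n

falses-falsesOnly : ∀ n → falses (replicate n false) ≡ n
falses-falsesOnly zero    = refl
falses-falsesOnly (suc n) = cong suc (falses-falsesOnly n)

-- Counting words with given numbers of letters.

WordsWith : ℕ → ℕ → Set
WordsWith i j = Σ Word λ w → trues w ≡ i × falses w ≡ j

wordsWith-≡ : ∀ {i j} {v w : WordsWith i j} → proj₁ v ≡ proj₁ w → v ≡ w
wordsWith-≡ {v = v , t , f} {.v , t′ , f′} refl
  rewrite ≡-irrelevant t t′ | ≡-irrelevant f f′ = refl

wordsWith-suc : ∀ i j → WordsWith (suc i) (suc j) ↔ (WordsWith i (suc j) ⊎ WordsWith (suc i) j)
wordsWith-suc i j = mk↔ₛ′ to from to∘from from∘to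
  where
  to : WordsWith (suc i) (suc j) → WordsWith i (suc j) ⊎ WordsWith (suc i) j
  to (true ∷ w  , t , f) = inj₁ (w , suc-injective t , f)
  to (false ∷ w , t , f) = inj₂ (w , t , suc-injective f)
  from : WordsWith i (suc j) ⊎ WordsWith (suc i) j → WordsWith (suc i) (suc j)
  from (inj₁ (w , t , f)) = true ∷ w , cong suc t , f
  from (inj₂ (w , t , f)) = false ∷ w , t , cong suc f
  to∘from : ∀ s → to (from s) ≡ s
  to∘from (inj₁ _) = cong inj₁ (wordsWith-≡ refl)
  to∘from (inj₂ _) = cong inj₂ (wordsWith-≡ refl)
  from∘to : ∀ w → from (to w) ≡ w
  from∘to (true ∷ w  , t , f) = wordsWith-≡ refl
  from∘to (false ∷ w , t , f) = wordsWith-≡ refl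

singleton↔ : ∀ {i j} (w : WordsWith i j) → (∀ v → proj₁ w ≡ proj₁ v) → Fin 1 ↔ WordsWith i j
singleton↔ w unique = mk↔ₛ′ (λ _ → w) (λ _ → zero)
  (λ v → wordsWith-≡ (unique v)) λ { zero → refl }

noTrues : ∀ j w → trues w ≡ 0 → falses w ≡ j → replicate j false ≡ w
noTrues zero    []          _ _ = refl
noTrues zero    (true ∷ w)  () _
noTrues zero    (false ∷ w) _ ()
noTrues (suc j) (false ∷ w) t f = cong (false ∷_) (noTrues j w t (suc-injective f))

noFalses : ∀ i w → trues w ≡ i → falses w ≡ 0 → replicate i true ≡ w
noFalses zero    []         _ _ = refl
noFalses zero    (true ∷ w)  () _
noFalses zero    (false ∷ w) _ ()
noFalses (suc i) (true ∷ w) t f = cong (true ∷_) (noFalses i w (suc-injective t) f)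

trues-truesOnly : ∀ n → trues (replicate n true) ≡ n
trues-truesOnly zero    = refl
trues-truesOnly (suc n) = cong suc (trues-truesOnly n)

falses-truesOnly : ∀ n → falses (replicate n true) ≡ 0
falses-truesOnly zero    = refl
falses-truesOnly (suc n) = falses-truesOnly n

-- Pascal's rule, read off the first letter. If one of the letters is absent, there is a single
-- word.
wordsWith-count : ∀ i j → Fin ((i + j) C i) ↔ WordsWith i j
wordsWith-count zero j =
  singleton↔ (replicate j false , trues-falsesOnly j , falses-falsesOnly j)
             λ (w , t , f) → noTrues j w t f
wordsWith-count (suc i) zero
  rewrite +-identityʳ i | nCn≡1 (suc i) =
  singleton↔ (replicate (suc i) true , trues-truesOnly (suc i) , falses-truesOnly (suc i))
             λ (w , t , f) → noFalses (suc i) w t f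
wordsWith-count (suc i) (suc j) = subst (λ n → Fin n ↔ WordsWith (suc i) (suc j)) pascal
  (↔-trans +↔⊎ (↔-trans (wordsWith-count i (suc j) ⊎-↔ wordsWith-count (suc i) j)
                        (↔-sym (wordsWith-suc i j))))
  where
  pascal : ((i + suc j) C i) + ((suc i + j) C suc i) ≡ (suc i + suc j) C suc i
  pascal = trans (cong (λ n → ((i + suc j) C i) + (n C suc i)) (sym (+-suc i j)))
                 (nCk+nC[k+1]≡[n+1]C[k+1] (i + suc j) i)

-- Padding words and gluing two of them into one.

padLeft padRight : ℕ → Maybe Word → Word
padLeft k nothing  = replicate k false
padLeft k (just x) = replicate (k ∸ falses x) false ++ true ∷ x
padRight k nothing  = replicate k false
padRight k (just y) = y ++ true ∷ replicate (k ∸ falses y) false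

-- Padding writes out the implicit `true`. It marks where stripping has to stop, so the amount of
-- padding need not be remembered.
stripLeft stripRight : Word → Maybe Word
stripLeft []          = nothing
stripLeft (true ∷ w)  = just w
stripLeft (false ∷ w) = stripLeft w
stripRight [] = nothing
stripRight (c ∷ w) = extend c (stripRight w)
  where
  extend : Bool → Maybe Word → Maybe Word
  extend c     (just y) = just (c ∷ y)
  extend true  nothing  = just []
  extend false nothing  = nothing

Fits : ℕ → Maybe Word → Set
Fits k nothing  = ⊤
Fits k (just w) = falses w ≤ k

-- The implicit `true` is counted. For the word of the pairs this is r, for that of the unpaired
-- parts it is s.
height : Maybe Word → ℕ
height nothing  = 0
height (just w) = suc (trues w)

trues-padLeft : ∀ k p → trues (padLeft k p) ≡ height p
trues-padLeft k nothing  = trues-falsesOnly k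
trues-padLeft k (just x) =
  trans (trues-++ (replicate (k ∸ falses x) false) _)
        (cong (_+ suc (trues x)) (trues-falsesOnly (k ∸ falses x)))

trues-padRight : ∀ k d → trues (padRight k d) ≡ height d
trues-padRight k nothing  = trues-falsesOnly k
trues-padRight k (just y) = trans (trues-++ y _)
  (trans (cong (λ n → trues y + suc n) (trues-falsesOnly (k ∸ falses y)))
         (+-comm (trues y) 1))

falses-padLeft : ∀ k p → Fits k p → falses (padLeft k p) ≡ k
falses-padLeft k nothing  _ = falses-falsesOnly k
falses-padLeft k (just x) h =
  trans (falses-++ (replicate (k ∸ falses x) false) _)
  (trans (cong (_+ falses x) (falses-falsesOnly (k ∸ falses x))) (m∸n+n≡m h))

falses-padRight : ∀ k d → Fits k d → falses (padRight k d) ≡ k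
falses-padRight k nothing  _ = falses-falsesOnly k
falses-padRight k (just y) h = trans (falses-++ y _)
  (trans (cong (falses y +_) (falses-falsesOnly (k ∸ falses y))) (m+[n∸m]≡n h))

stripLeft-padLeft : ∀ k p → stripLeft (padLeft k p) ≡ p
stripLeft-padLeft k nothing = go k
  where
  go : ∀ n → stripLeft (replicate n false) ≡ nothing
  go zero    = refl
  go (suc n) = go n
stripLeft-padLeft k (just x) = go (k ∸ falses x)
  where
  go : ∀ n → stripLeft (replicate n false ++ true ∷ x) ≡ just x
  go zero    = refl
  go (suc n) = go n

stripRight-falses : ∀ n → stripRight (replicate n false) ≡ nothing
stripRight-falses zero    = refl
stripRight-falses (suc n) rewrite stripRight-falses n = refl

stripRight-padRight : ∀ k d → stripRight (padRight k d) ≡ d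
stripRight-padRight k nothing  = stripRight-falses k
stripRight-padRight k (just y) = go y
  where
  n = k ∸ falses y
  go : ∀ z → stripRight (z ++ true ∷ replicate n false) ≡ just z
  go [] rewrite stripRight-falses n = refl
  go (c ∷ z) rewrite go z = refl

stripLeft-fits : ∀ w → Fits (falses w) (stripLeft w)
stripLeft-fits []          = tt
stripLeft-fits (true ∷ w)  = ≤-refl
stripLeft-fits (false ∷ w) with stripLeft w | stripLeft-fits w
... | nothing | _ = tt
... | just _  | h = m≤n⇒m≤1+n h

stripRight-fits : ∀ w → Fits (falses w) (stripRight w)
stripRight-fits [] = tt
stripRight-fits (c ∷ w) with stripRight w | stripRight-fits w
stripRight-fits (true ∷ w)  | nothing | _ = z≤n
stripRight-fits (false ∷ w) | nothing | _ = tt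
stripRight-fits (true ∷ w)  | just _  | h = h
stripRight-fits (false ∷ w) | just _  | h = s≤s h

padLeft-stripLeft : ∀ w → padLeft (falses w) (stripLeft w) ≡ w
padLeft-stripLeft [] = refl
padLeft-stripLeft (true ∷ w) rewrite n∸n≡0 (falses w) = refl
padLeft-stripLeft (false ∷ w)
  with stripLeft w | stripLeft-fits w | padLeft-stripLeft w
... | nothing | _ | h = cong (false ∷_) h
... | just x  | x≤ | h rewrite +-∸-assoc 1 x≤ = cong (false ∷_) h

padRight-stripRight : ∀ w → padRight (falses w) (stripRight w) ≡ w
padRight-stripRight [] = refl
padRight-stripRight (c ∷ w) with stripRight w | padRight-stripRight w
padRight-stripRight (true ∷ w)  | nothing | h = cong (true ∷_) h
padRight-stripRight (false ∷ w) | nothing | h = cong (false ∷_) h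
padRight-stripRight (true ∷ w)  | just _  | h = cong (true ∷_) h
padRight-stripRight (false ∷ w) | just _  | h = cong (false ∷_) h

-- With p = just x standing for the word true ∷ x ++ [ false ], and d = just y for
-- y ++ [ true ], one word is padded with falses (p on the left, d on the right) to
-- balance the other, and one of the implicit letters is dropped.  The parity of the
-- number of falses of the result tells the cases apart.
data Shape : Maybe Word → Maybe Word → Set where
  empty       : Shape nothing nothing
  noFalse     : ∀ y → falses y ≡ 0 → Shape nothing (just y)
  pairsWider  : ∀ x d → Fits (falses x) d → Shape (just x) d
  singlesWider : ∀ p y k → falses y ≡ suc k → Fits k p → Shape p (just y)

-- For two actual words the spans `2 * suc (falses x)` and `2 * falses y + 1` differ in parity, so
-- there are no ties: the pairs are wider exactly when `falses y ≤ falses x`.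
shape : ∀ p d → Shape p d
shape nothing  nothing  = empty
shape (just x) nothing  = pairsWider x nothing tt
shape nothing  (just y) with falses y in eq
... | zero  = noFalse y eq
... | suc k = singlesWider nothing y k eq tt
shape (just x) (just y) with falses y in eq
... | zero  = pairsWider x (just y) (subst (_≤ falses x) (sym eq) z≤n)
... | suc k with falses x ≤? k
...   | yes x≤k = singlesWider (just x) y k eq x≤k
...   | no  x≰k = pairsWider x (just y) (subst (_≤ falses x) (sym eq) (≰⇒> x≰k))

shapeWord : ∀ {p d} → Shape p d → Word
shapeWord empty                  = []
shapeWord (noFalse y _)          = y
shapeWord (pairsWider x d _)     = x ++ false ∷ padRight (falses x) d
shapeWord (singlesWider p y k _ _) = padLeft k p ++ false ∷ y

-- The inequalities of the two main cases exclude each other, and the word does not depend on the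
-- proofs stored in a shape. So `merge` can be computed from any shape at hand instead of the one
-- that `shape` selects.
shapeWord-unique : ∀ {p d} (s t : Shape p d) → shapeWord s ≡ shapeWord t
shapeWord-unique empty empty = refl
shapeWord-unique (noFalse y _) (noFalse .y _) = refl
shapeWord-unique (noFalse y e) (singlesWider _ .y k e′ _) = contradiction (trans (sym e) e′) 0≢1+n
shapeWord-unique (singlesWider _ y k e′ _) (noFalse .y e) = contradiction (trans (sym e) e′) 0≢1+n
shapeWord-unique (pairsWider x d _) (pairsWider .x .d _) = refl
shapeWord-unique (pairsWider x _ y≤x) (singlesWider _ y k e x≤k) =
  contradiction (≤-trans (subst (_≤ _) e y≤x) x≤k) (n≮n k)
shapeWord-unique (singlesWider _ y k e x≤k) (pairsWider x _ y≤x) =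
  contradiction (≤-trans (subst (_≤ _) e y≤x) x≤k) (n≮n k)
shapeWord-unique (singlesWider p y k e _) (singlesWider .p .y k′ e′ _) =
  cong (λ n → padLeft n p ++ false ∷ y) (suc-injective (trans (sym e) e′))

merge : Maybe Word → Maybe Word → Word
merge p d = shapeWord (shape p d)

-- `odd k` stands for 2k + 1 and `even k` for 2k + 2. In a glued word of the shape `pairsWider` or
-- `singlesWider`, respectively, `k` is the number of letters `false` before the separating one.
data Half : Set where
  none : Half
  odd even : ℕ → Half

half : ℕ → Half
half zero          = none
half (suc zero)    = odd 0
half (suc (suc n)) = bump (half n)
  where
  bump : Half → Half
  bump none     = even 0
  bump (odd k)  = odd (suc k)
  bump (even k) = even (suc k)

half-odd : ∀ k → half (k + suc k) ≡ odd k
half-odd zero    = refl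
half-odd (suc k) rewrite +-suc k (suc k) | half-odd k = refl

half-even : ∀ k → half (k + suc (suc k)) ≡ even k
half-even zero    = refl
half-even (suc k) rewrite +-suc k (suc (suc k)) | half-even k = refl

double : Half → ℕ
double none     = 0
double (odd k)  = k + suc k
double (even k) = k + suc (suc k)

double-half : ∀ n → double (half n) ≡ n
double-half zero          = refl
double-half (suc zero)    = refl
double-half (suc (suc n)) with half n | double-half n
... | none   | refl = refl
... | odd k  | refl = cong suc (+-suc k (suc k))
... | even k | refl = cong suc (+-suc k (suc (suc k)))

splitAtFalse : ℕ → Word → Word × Word
-- An arbitrary value, excluded wherever `k < falses w`.
splitAtFalse k       []          = [] , []
splitAtFalse zero    (false ∷ w) = [] , w
splitAtFalse (suc k) (false ∷ w) = let u , v = splitAtFalse k w in false ∷ u , v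
splitAtFalse k       (true ∷ w)  = let u , v = splitAtFalse k w in true ∷ u , v

splitAtFalse-++ : ∀ u v → splitAtFalse (falses u) (u ++ false ∷ v) ≡ (u , v)
splitAtFalse-++ []          v = refl
splitAtFalse-++ (true ∷ u)  v with falses u | splitAtFalse-++ u v
... | zero  | h rewrite h = refl
... | suc _ | h rewrite h = refl
splitAtFalse-++ (false ∷ u) v rewrite splitAtFalse-++ u v = refl

splitAtFalse-correct : ∀ k w → k < falses w → let u , v = splitAtFalse k w in
  u ++ false ∷ v ≡ w × falses u ≡ k
splitAtFalse-correct zero    (false ∷ w) _ = refl , refl
splitAtFalse-correct (suc k) (false ∷ w) (s≤s h) =
  let e , f = splitAtFalse-correct k w h in cong (false ∷_) e , cong suc f
splitAtFalse-correct zero    (true ∷ w) h =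
  let e , f = splitAtFalse-correct zero w h in cong (true ∷_) e , f
splitAtFalse-correct (suc k) (true ∷ w) h =
  let e , f = splitAtFalse-correct (suc k) w h in cong (true ∷_) e , f

unmerge′ : Half → Word → Maybe Word × Maybe Word
unmerge′ none     w = nothing , just w
unmerge′ (odd k)  w = let x , v = splitAtFalse k w in just x , stripRight v
unmerge′ (even k) w = let u , y = splitAtFalse k w in stripLeft u , just y

unmerge : Word → Maybe Word × Maybe Word
unmerge w = unmerge′ (half (falses w)) w

-- The total number of letters `false` leaves, after the separating one, as many as before it in the
-- odd case and one more in the even case. So the stripped side fits, and padding it to the `k` of
-- the shape restores it.
merge-unmerge : ∀ w → let p , d = unmerge w in merge p d ≡ w
merge-unmerge w with half (falses w) | double-half (falses w)
... | none  | e = shapeWord-unique (shape nothing (just w)) (noFalse w (sym e))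
... | odd k | e with splitAtFalse k w | splitAtFalse-correct k w (subst (k <_) e (m≤n+m (suc k) k))
...   | x , v | refl , refl = trans
  (shapeWord-unique (shape (just x) (stripRight v)) (pairsWider x (stripRight v)
    (subst (λ n → Fits n (stripRight v)) v≡x (stripRight-fits v))))
  (cong (λ z → x ++ false ∷ z)
    (subst (λ n → padRight n (stripRight v) ≡ v) v≡x (padRight-stripRight v)))
  where
  v≡x : falses v ≡ falses x
  v≡x = suc-injective (+-cancelˡ-≡ (falses x) _ _ (sym (trans e (falses-++ x (false ∷ v)))))
merge-unmerge w | even k | e
  with splitAtFalse k w | splitAtFalse-correct k w (subst (k <_) e (m≤n⇒m≤o+n k (n≤1+n (suc k))))
...   | u , y | refl , refl = trans
  (shapeWord-unique (shape (stripLeft u) (just y)) (singlesWider (stripLeft u) y (falses u)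
    (suc-injective (+-cancelˡ-≡ (falses u) _ _ (sym (trans e (falses-++ u (false ∷ y))))))
    (stripLeft-fits u)))
  (cong (_++ false ∷ y) (padLeft-stripLeft u))

-- Excludes the empty partition only. Its glued word `[]` is also that of `(nothing , just [])`, the
-- partition with the single part 1.
NonEmpty : Maybe Word × Maybe Word → Set
NonEmpty (p , d) = height p + height d ≢ 0

unmerge-nonEmpty : ∀ w → NonEmpty (unmerge w)
unmerge-nonEmpty w with half (falses w)
... | none   = λ ()
... | odd k  = λ ()
... | even k = λ h → contradiction (m+n≡0⇒n≡0 (height (stripLeft (proj₁ (splitAtFalse k w)))) h) λ ()

unmerge-shape : ∀ {p d} (s : Shape p d) → NonEmpty (p , d) → unmerge (shapeWord s) ≡ (p , d)
unmerge-shape empty ne = contradiction refl ne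
unmerge-shape (noFalse y e) _ rewrite e = refl
unmerge-shape (pairsWider x d h) _
  rewrite falses-++ x (false ∷ padRight (falses x) d) | falses-padRight (falses x) d h
        | half-odd (falses x) | splitAtFalse-++ x (padRight (falses x) d)
        | stripRight-padRight (falses x) d = refl
unmerge-shape (singlesWider p y k e h) _ with falses-padLeft k p h
... | f rewrite falses-++ (padLeft k p) (false ∷ y) | e | f | half-even k
        with splitAtFalse-++ (padLeft k p) y
...     | g rewrite f | g | stripLeft-padLeft k p = refl

-- Each `false` in the word of the pairs, with the implicit one, is a pair and so two parts. In the
-- other word `falses y` is the difference of u₁ and s.
wordPairSpan wordResidualSpan : Maybe Word → ℕ
wordPairSpan nothing  = 0
wordPairSpan (just x) = 2 * suc (falses x)
wordResidualSpan nothing  = 0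
wordResidualSpan (just y) = 2 * falses y + 1

-- Of the implicit letters `true`, that of the wider word is dropped and that of the padded word, if
-- there is one, is written out; hence the `suc`.
trues-shape : ∀ {p d} (s : Shape p d) → NonEmpty (p , d) →
  suc (trues (shapeWord s)) ≡ height p + height d
trues-shape empty ne = contradiction refl ne
trues-shape (noFalse y _) _ = refl
trues-shape (pairsWider x d _) _ =
  cong suc (trans (trues-++ x _) (cong (trues x +_) (trues-padRight (falses x) d)))
trues-shape (singlesWider p y k _ _) _ =
  trans (cong suc (trans (trues-++ (padLeft k p) _) (cong (_+ trues y) (trues-padLeft k p))))
        (sym (+-suc (height p) (trues y)))

-- One more than 2k + 1 is the pair span when `falses x` is k; one more than 2k + 2 is the residual
-- span when `falses y` is k + 1.
falses-shape : ∀ {p d} (s : Shape p d) → NonEmpty (p , d) →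
  suc (falses (shapeWord s)) ≡ wordPairSpan p ⊔ wordResidualSpan d
falses-shape empty ne = contradiction refl ne
falses-shape (noFalse y e) _ rewrite e = refl
falses-shape (pairsWider x d h) _ = begin
  suc (falses (x ++ false ∷ padRight (falses x) d))
    ≡⟨ cong suc (falses-++ x _) ⟩
  suc (falses x) + suc (falses (padRight (falses x) d))
    ≡⟨ cong (λ n → suc (falses x) + suc n) (falses-padRight (falses x) d h) ⟩
  suc (falses x) + suc (falses x)
    ≡⟨ cong (suc (falses x) +_) (+-identityʳ (suc (falses x))) ⟨
  2 * suc (falses x)
    ≡⟨ m≥n⇒m⊔n≡m (bound d h) ⟨
  2 * suc (falses x) ⊔ wordResidualSpan d ∎
  where
  open ≡-Reasoning
  bound : ∀ d → Fits (falses x) d → wordResidualSpan d ≤ 2 * suc (falses x)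
  bound nothing  _ = z≤n
  bound (just y) h = ≤-trans (+-mono-≤ (*-monoʳ-≤ 2 h) (n≤1+n 1))
    (≤-reflexive (trans (+-comm (2 * falses x) 2) (sym (*-suc 2 (falses x)))))
falses-shape (singlesWider p y k e h) _ rewrite e = begin
  suc (falses (padLeft k p ++ false ∷ y))
    ≡⟨ cong suc (falses-++ (padLeft k p) _) ⟩
  suc (falses (padLeft k p) + suc (falses y))
    ≡⟨ cong₂ (λ a b → suc (a + suc b)) (falses-padLeft k p h) e ⟩
  suc k + suc (suc k)
    ≡⟨ cong (suc k +_) (trans (cong suc (sym (+-identityʳ (suc k)))) (+-comm 1 (suc k + 0))) ⟩
  suc k + (suc k + 0 + 1)
    ≡⟨ +-assoc (suc k) (suc k + 0) 1 ⟨
  2 * suc k + 1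
    ≡⟨ m≤n⇒m⊔n≡n (bound p h) ⟨
  wordPairSpan p ⊔ (2 * suc k + 1) ∎
  where
  open ≡-Reasoning
  bound : ∀ p → Fits k p → wordPairSpan p ≤ 2 * suc k + 1
  bound nothing  _ = z≤n
  bound (just x) h = ≤-trans (*-monoʳ-≤ 2 (s≤s h)) (m≤m+n _ 1)

-- Multiplicities in lists of numbers

occurrences : ℕ → List ℕ → ℕ
occurrences i xs = length (filter (i ≟_) xs)

occurrences-++ : ∀ i xs ys → occurrences i (xs ++ ys) ≡ occurrences i xs + occurrences i ys
occurrences-++ i xs ys = trans (cong length (filter-++ (i ≟_) xs ys)) (length-++ (filter (i ≟_) xs))

occurrences-here : ∀ x xs → occurrences x (x ∷ xs) ≡ suc (occurrences x xs)
occurrences-here x xs = cong length (filter-accept (x ≟_) {xs = xs} refl)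

occurrences-map-suc : ∀ i xs → occurrences (suc i) (map suc xs) ≡ occurrences i xs
occurrences-map-suc i []       = refl
occurrences-map-suc i (x ∷ xs) with i ≡ᵇ x
... | true  = cong suc (occurrences-map-suc i xs)
... | false = occurrences-map-suc i xs

occurrences-zero-map-suc : ∀ xs → occurrences 0 (map suc xs) ≡ 0
occurrences-zero-map-suc []       = refl
occurrences-zero-map-suc (x ∷ xs) = occurrences-zero-map-suc xs

occurrences-replicate : ∀ n x → occurrences x (replicate n x) ≡ n
occurrences-replicate zero    x = refl
occurrences-replicate (suc n) x =
  trans (occurrences-here x (replicate n x)) (cong suc (occurrences-replicate n x))

occurrences-none : ∀ {i xs} → All (i ≢_) xs → occurrences i xs ≡ 0
occurrences-none {i} h = cong length (filter-none (i ≟_) h)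

occurrences-zero : ∀ {xs} → All NonZero xs → occurrences 0 xs ≡ 0
occurrences-zero = occurrences-none ∘ All.map (λ nz e → ≢-nonZero⁻¹ _ {{nz}} (sym e))

sum<i⇒occurrences≡0 : ∀ {i} xs → sum xs < i → occurrences i xs ≡ 0
sum<i⇒occurrences≡0 []       _ = refl
sum<i⇒occurrences≡0 (x ∷ xs) h =
  trans (cong length (filter-reject (_ ≟_) {xs = xs} λ e →
          <⇒≢ (≤-<-trans (m≤m+n x (sum xs)) h) (sym e)))
        (sum<i⇒occurrences≡0 xs (≤-<-trans (m≤n+m (sum xs) x) h))

occurs⇒≤head : ∀ {x y ys} → All (y ≥_) ys → occurrences x (y ∷ ys) ≢ 0 → x ≤ y
occurs⇒≤head {x} {y} y≥ys h = ≮⇒≥ λ y<x →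
  h (occurrences-none (>⇒≢ y<x ∷ All.map (λ z≤y → >⇒≢ (≤-<-trans z≤y y<x)) y≥ys))

-- Each head occurs in the other list and so is at most its head. The heads agree and can be
-- removed.
decreasing-unique : ∀ {xs ys} → AllPairs _≥_ xs → AllPairs _≥_ ys →
  (∀ i → occurrences i xs ≡ occurrences i ys) → xs ≡ ys
decreasing-unique {[]}     {[]}     _ _ _ = refl
decreasing-unique {[]}     {y ∷ ys} _ _ h =
  contradiction (trans (h y) (occurrences-here y ys)) 0≢1+n
decreasing-unique {x ∷ xs} {[]}     _ _ h =
  contradiction (trans (sym (h x)) (occurrences-here x xs)) 0≢1+n
decreasing-unique {x ∷ xs} {y ∷ ys} (x≥ ∷ xs↘) (y≥ ∷ ys↘) h
  with ≤-antisym
         (occurs⇒≤head y≥ λ e → 1+n≢0 (trans (sym (occurrences-here x xs)) (trans (h x) e)))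
         (occurs⇒≤head x≥ λ e → 1+n≢0 (trans (sym (occurrences-here y ys)) (trans (sym (h y)) e)))
... | refl = cong (x ∷_) (decreasing-unique xs↘ ys↘ λ i →
  +-cancelˡ-≡ (occurrences i (x ∷ [])) _ _
    (trans (sym (occurrences-++ i (x ∷ []) xs)) (trans (h i) (occurrences-++ i (x ∷ []) ys))))

-- Partitions as lists of the multiplicities of 1, 2, 3, …, up to trailing zeros

build : List ℕ → List ℕ
build []       = []
build (m ∷ ms) = map suc (build ms) ++ replicate m 1

lookupOr : {A : Set} → A → List A → ℕ → A
lookupOr d []       _       = d
lookupOr d (x ∷ xs) zero    = x
lookupOr d (x ∷ xs) (suc i) = lookupOr d xs i

build-positive : ∀ ms → All NonZero (build ms)
build-positive []       = []
build-positive (m ∷ ms) =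
  All.++⁺ (All.map⁺ (All.tabulate λ _ → _)) (All.replicate⁺ m _)

build-decreasing : ∀ ms → AllPairs _≥_ (build ms)
build-decreasing []       = []
build-decreasing (m ∷ ms) = AllPairs.++⁺
  (AllPairs.map⁺ (AllPairs.map s≤s (build-decreasing ms)))
  (ones m)
  (All.map⁺ (All.tabulate λ _ → All.replicate⁺ m (s≤s z≤n)))
  where
  ones : ∀ m → AllPairs _≥_ (replicate m 1)
  ones zero    = []
  ones (suc m) = All.replicate⁺ m ≤-refl ∷ ones m

occurrences-build-1 : ∀ m ms → occurrences 1 (build (m ∷ ms)) ≡ m
occurrences-build-1 m ms = begin
  occurrences 1 (map suc (build ms) ++ replicate m 1)
    ≡⟨ occurrences-++ 1 (map suc (build ms)) (replicate m 1) ⟩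
  occurrences 1 (map suc (build ms)) + occurrences 1 (replicate m 1)
    ≡⟨ cong₂ _+_ (trans (occurrences-map-suc 0 (build ms)) (occurrences-zero (build-positive ms)))
                 (occurrences-replicate m 1) ⟩
  m ∎
  where open ≡-Reasoning

occurrences-build-suc : ∀ m ms i → .{{_ : NonZero i}} →
  occurrences (suc i) (build (m ∷ ms)) ≡ occurrences i (build ms)
occurrences-build-suc m ms (suc i) = begin
  occurrences (2 + i) (map suc (build ms) ++ replicate m 1)
    ≡⟨ occurrences-++ (2 + i) (map suc (build ms)) (replicate m 1) ⟩
  occurrences (2 + i) (map suc (build ms)) + occurrences (2 + i) (replicate m 1)
    ≡⟨ cong₂ _+_ (occurrences-map-suc (suc i) (build ms))
                 (occurrences-none (All.replicate⁺ m λ ())) ⟩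
  occurrences (suc i) (build ms) + 0
    ≡⟨ +-identityʳ _ ⟩
  occurrences (suc i) (build ms) ∎
  where open ≡-Reasoning

occurrences-build : ∀ ms i → occurrences (suc i) (build ms) ≡ lookupOr 0 ms i
occurrences-build []       i       = refl
occurrences-build (m ∷ ms) zero    = occurrences-build-1 m ms
occurrences-build (m ∷ ms) (suc i) =
  trans (occurrences-build-suc m ms (suc i)) (occurrences-build ms i)

onesIf : Bool → List ℕ
onesIf true  = 1 ∷ []
onesIf false = []

filter-map-suc : ∀ {P Q : Pred ℕ 0ℓ} (P? : Decidable P) (Q? : Decidable Q) {xs} →
  All (λ x → does (P? (suc x)) ≡ does (Q? x)) xs →
  filter P? (map suc xs) ≡ map suc (filter Q? xs)
filter-map-suc P? Q? []               = refl
filter-map-suc P? Q? (_∷_ {x} eq eqs) rewrite eq with does (Q? x)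
... | true  = cong (suc x ∷_) (filter-map-suc P? Q? eqs)
... | false = filter-map-suc P? Q? eqs

-- Raised positive parts are at least 2, so the ones at the end meet no equal part among them and
-- survive as one copy.
deduplicate-shift : ∀ m {xs} → All NonZero xs →
  deduplicate _≟_ (map suc xs ++ replicate m 1) ≡
  map suc (deduplicate _≟_ xs) ++ onesIf (does (1 ≤? m))
deduplicate-shift zero    [] = refl
deduplicate-shift (suc m) [] rewrite deduplicate-shift m [] with m
... | zero  = refl
... | suc _ = refl
deduplicate-shift m (_∷_ {suc x} {xs} nz nzs)
  rewrite deduplicate-shift m nzs
        | filter-++ (¬? ∘ (suc (suc x) ≟_)) (map suc (deduplicate _≟_ xs)) (onesIf (does (1 ≤? m)))
  = cong (2 + x ∷_) (cong₂ _++_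
      (filter-map-suc (¬? ∘ (suc (suc x) ≟_)) (¬? ∘ (suc x ≟_)) {deduplicate _≟_ xs}
        (All.tabulate λ _ → refl))
      (keepsOnes (does (1 ≤? m))))
  where
  keepsOnes : ∀ b → filter (¬? ∘ (suc (suc x) ≟_)) (onesIf b) ≡ onesIf b
  keepsOnes true  = refl
  keepsOnes false = refl

sizes : List ℕ → List ℕ
sizes ms = deduplicate _≟_ (build ms)

sizes-positive : ∀ ms → All NonZero (sizes ms)
sizes-positive ms = All.deduplicate⁺ _≟_ (build-positive ms)

sizesWith : {P : Pred ℕ 0ℓ} → Decidable P → List ℕ → List ℕ
sizesWith P? ms = filter (λ i → P? (occurrences i (build ms))) (sizes ms)

-- The common recursion for paired sizes and unpaired parts. If `m` is 0, then 1 is not among the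
-- sizes, so `P` must reject 0 for the last term to be right.
sizesWith-∷ : ∀ {P : Pred ℕ 0ℓ} (P? : Decidable P) → ¬ P 0 → ∀ m ms →
  sizesWith P? (m ∷ ms) ≡ map suc (sizesWith P? ms) ++ onesIf (does (P? m))
sizesWith-∷ P? ¬P0 m ms
  rewrite deduplicate-shift m (build-positive ms)
        | filter-++ (λ i → P? (occurrences i (build (m ∷ ms)))) (map suc (sizes ms)) (onesIf (does (1 ≤? m))) =
  cong₂ _++_
    (filter-map-suc (λ i → P? (occurrences i (build (m ∷ ms)))) (λ i → P? (occurrences i (build ms)))
      (All.map (λ {i} nz → cong (does ∘ P?) (occurrences-build-suc m ms i {{nz}})) (sizes-positive ms)))
    (atOne m)
  where
  atOne : ∀ m → filter (λ i → P? (occurrences i (build (m ∷ ms)))) (onesIf (does (1 ≤? m)))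
             ≡ onesIf (does (P? m))
  atOne zero    = cong onesIf (sym (dec-false (P? 0) ¬P0))
  atOne (suc m) rewrite occurrences-build-1 (suc m) ms with does (P? (suc m))
  ... | true  = refl
  ... | false = refl

sum-sizes-∷ : ∀ (f : ℕ → ℕ) → f 0 ≡ 0 → ∀ m ms →
  sum (map (λ i → f (occurrences i (build (m ∷ ms)))) (sizes (m ∷ ms))) ≡
  sum (map (λ i → f (occurrences i (build ms))) (sizes ms)) + f m
sum-sizes-∷ f f0 m ms
  rewrite deduplicate-shift m (build-positive ms)
        | map-++ (λ i → f (occurrences i (build (m ∷ ms)))) (map suc (sizes ms)) (onesIf (does (1 ≤? m)))
        | sum-++ (map (λ i → f (occurrences i (build (m ∷ ms)))) (map suc (sizes ms)))
                 (map (λ i → f (occurrences i (build (m ∷ ms)))) (onesIf (does (1 ≤? m)))) =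
  cong₂ _+_ (shifted (sizes-positive ms)) (atOne m)
  where
  shifted : ∀ {xs} → All NonZero xs →
    sum (map (λ i → f (occurrences i (build (m ∷ ms)))) (map suc xs)) ≡
    sum (map (λ i → f (occurrences i (build ms))) xs)
  shifted []               = refl
  shifted (_∷_ {i} nz nzs) =
    cong₂ _+_ (cong f (occurrences-build-suc m ms i {{nz}})) (shifted nzs)
  atOne : ∀ m → sum (map (λ i → f (occurrences i (build (m ∷ ms)))) (onesIf (does (1 ≤? m)))) ≡ f m
  atOne zero    = sym f0
  atOne (suc m) = trans (+-identityʳ _) (cong f (occurrences-build-1 (suc m) ms))

-- Encoding multiplicities as two words.

-- Adding k pairs of parts 1 after raising all parts by one.  The letters after
-- the first true (which raises the size to 1) are read from the smallest size
-- upwards; the last false, a pair of the largest size, is left implicit too.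
addPairs : ℕ → Maybe Word → Maybe Word
addPairs k       (just x) = just (replicate k false ++ true ∷ x)
addPairs (suc k) nothing  = just (replicate k false)
addPairs zero    nothing  = nothing

-- On the empty word this is the implicit last `true`.
lowest : Word → Bool
lowest []      = true
lowest (c ∷ _) = c

-- Letter i of y followed by an implicit true tells whether the number of unpaired
-- parts ≥ i is odd, so consecutive letters differ exactly at an unpaired part.
addSingle : Bool → Maybe Word → Maybe Word
addSingle b     (just y) = just ((lowest y xor b) ∷ y)
addSingle true  nothing  = just []
addSingle false nothing  = nothing

pairWord : List ℕ → Maybe Word
pairWord = foldr addPairs nothing

singleWord : List Bool → Maybe Word
singleWord = foldr addSingle nothing

odd? : ℕ → Bool
odd? m = does (m % 2 ≟ 1)

encode : List ℕ → Maybe Word × Maybe Word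
encode ms = pairWord (map (_/ 2) ms) , singleWord (map odd? ms)

lookupOr-map : ∀ {A B : Set} (f : A → B) d xs i → lookupOr (f d) (map f xs) i ≡ f (lookupOr d xs i)
lookupOr-map f d []       i       = refl
lookupOr-map f d (x ∷ xs) zero    = refl
lookupOr-map f d (x ∷ xs) (suc i) = lookupOr-map f d xs i

-- Trailing default entries are absorbed by `f d e ≡ e`. This makes `encode` insensitive to trailing
-- zeros.
foldr-lookupOr-cong : ∀ {A B : Set} (f : A → B → B) d e → f d e ≡ e → ∀ xs ys →
  (∀ i → lookupOr d xs i ≡ lookupOr d ys i) → foldr f e xs ≡ foldr f e ys
foldr-lookupOr-cong f d e fde []       []       h = refl
foldr-lookupOr-cong f d e fde []       (y ∷ ys) h =
  trans (sym fde) (cong₂ f (h 0) (foldr-lookupOr-cong f d e fde [] ys (h ∘ suc)))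
foldr-lookupOr-cong f d e fde (x ∷ xs) []       h =
  trans (cong₂ f (h 0) (foldr-lookupOr-cong f d e fde xs [] (h ∘ suc))) fde
foldr-lookupOr-cong f d e fde (x ∷ xs) (y ∷ ys) h =
  cong₂ f (h 0) (foldr-lookupOr-cong f d e fde xs ys (h ∘ suc))

encode-cong : ∀ ms ns → (∀ i → lookupOr 0 ms i ≡ lookupOr 0 ns i) → encode ms ≡ encode ns
encode-cong ms ns h = cong₂ _,_
  (foldr-lookupOr-cong addPairs 0 nothing refl (map (_/ 2) ms) (map (_/ 2) ns) (mapped (_/ 2)))
  (foldr-lookupOr-cong addSingle false nothing refl (map odd? ms) (map odd? ns) (mapped odd?))
  where
  mapped : ∀ {A : Set} (f : ℕ → A) i → lookupOr (f 0) (map f ms) i ≡ lookupOr (f 0) (map f ns) i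
  mapped f i = trans (lookupOr-map f 0 ms i) (trans (cong f (h i)) (sym (lookupOr-map f 0 ns i)))

-- Decoding two words into multiplicities.

incrementHead : List ℕ → List ℕ
incrementHead []       = 1 ∷ []
incrementHead (k ∷ ks) = suc k ∷ ks

pairCounts : Maybe Word → List ℕ
pairCounts nothing            = []
-- The implicit last `false`, a pair of the largest paired size.
pairCounts (just [])          = 1 ∷ []
pairCounts (just (true ∷ x))  = 0 ∷ pairCounts (just x)
pairCounts (just (false ∷ x)) = incrementHead (pairCounts (just x))

singleFlags : Maybe Word → List Bool
singleFlags nothing        = []
-- The implicit last `true` ends at the largest unpaired part.
singleFlags (just [])      = true ∷ []
singleFlags (just (c ∷ y)) = (lowest y xor c) ∷ singleFlags (just y)

bit : Bool → ℕ
bit true  = 1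
bit false = 0

combine : List ℕ → List Bool → List ℕ
combine []       []       = []
combine []       (e ∷ es) = bit e + 0 * 2 ∷ combine [] es
combine (k ∷ ks) []       = 0 + k * 2 ∷ combine ks []
combine (k ∷ ks) (e ∷ es) = bit e + k * 2 ∷ combine ks es

decode : Maybe Word × Maybe Word → List ℕ
decode (p , d) = combine (pairCounts p) (singleFlags d)

pairWord-incrementHead : ∀ ks {x} → pairWord ks ≡ just x → pairWord (incrementHead ks) ≡ just (false ∷ x)
pairWord-incrementHead (k ∷ ks) h with pairWord ks
pairWord-incrementHead (k ∷ ks)     refl | just _  = refl
pairWord-incrementHead (suc k ∷ ks) refl | nothing = refl

pairWord-pairCounts : ∀ p → pairWord (pairCounts p) ≡ p
pairWord-pairCounts nothing            = refl
pairWord-pairCounts (just [])          = refl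
pairWord-pairCounts (just (true ∷ x))  rewrite pairWord-pairCounts (just x) = refl
pairWord-pairCounts (just (false ∷ x)) =
  pairWord-incrementHead (pairCounts (just x)) (pairWord-pairCounts (just x))

xor-cancel : ∀ a b → a xor (a xor b) ≡ b
xor-cancel true  b = not-involutive b
xor-cancel false b = refl

singleWord-singleFlags : ∀ d → singleWord (singleFlags d) ≡ d
singleWord-singleFlags nothing   = refl
singleWord-singleFlags (just []) = refl
singleWord-singleFlags (just (c ∷ y))
  rewrite singleWord-singleFlags (just y) | xor-cancel (lowest y) c = refl

[bit+k*2]/2 : ∀ e k → (bit e + k * 2) / 2 ≡ k
[bit+k*2]/2 false k = m*n/n≡m k 2
[bit+k*2]/2 true  k = trans (+-distrib-/-∣ʳ 1 {k * 2} {2} (n∣m*n k)) (m*n/n≡m k 2)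

odd?[bit+k*2] : ∀ e k → odd? (bit e + k * 2) ≡ e
odd?[bit+k*2] true  k = cong (λ n → does (n ≟ 1)) ([m+kn]%n≡m%n 1 k 2)
odd?[bit+k*2] false k = cong (λ n → does (n ≟ 1)) ([m+kn]%n≡m%n 0 k 2)

bit[odd?]+[m/2]*2 : ∀ m → bit (odd? m) + m / 2 * 2 ≡ m
bit[odd?]+[m/2]*2 m = trans (cong (_+ m / 2 * 2) (bit-odd (m % 2) (m%n<n m 2))) (sym (m≡m%n+[m/n]*n m 2))
  where
  bit-odd : ∀ n → n < 2 → bit (does (n ≟ 1)) ≡ n
  bit-odd 0 _ = refl
  bit-odd 1 _ = refl
  bit-odd (suc (suc _)) (s≤s (s≤s ()))

pairWord-combine : ∀ ks es → pairWord (map (_/ 2) (combine ks es)) ≡ pairWord ks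
pairWord-combine []       []       = refl
pairWord-combine []       (e ∷ es) = cong₂ addPairs ([bit+k*2]/2 e 0) (pairWord-combine [] es)
pairWord-combine (k ∷ ks) []       = cong₂ addPairs ([bit+k*2]/2 false k) (pairWord-combine ks [])
pairWord-combine (k ∷ ks) (e ∷ es) = cong₂ addPairs ([bit+k*2]/2 e k) (pairWord-combine ks es)

singleWord-combine : ∀ ks es → singleWord (map odd? (combine ks es)) ≡ singleWord es
singleWord-combine []       []       = refl
singleWord-combine []       (e ∷ es) = cong₂ addSingle (odd?[bit+k*2] e 0) (singleWord-combine [] es)
singleWord-combine (k ∷ ks) []       = cong₂ addSingle (odd?[bit+k*2] false k) (singleWord-combine ks [])
singleWord-combine (k ∷ ks) (e ∷ es) = cong₂ addSingle (odd?[bit+k*2] e k) (singleWord-combine ks es)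

encode-decode : ∀ pd → encode (decode pd) ≡ pd
encode-decode (p , d) = cong₂ _,_
  (trans (pairWord-combine (pairCounts p) (singleFlags d)) (pairWord-pairCounts p))
  (trans (singleWord-combine (pairCounts p) (singleFlags d)) (singleWord-singleFlags d))

lookupOr-combine : ∀ ks es i →
  lookupOr 0 (combine ks es) i ≡ bit (lookupOr false es i) + lookupOr 0 ks i * 2
lookupOr-combine []       []       i       = refl
lookupOr-combine []       (e ∷ es) zero    = refl
lookupOr-combine []       (e ∷ es) (suc i) = lookupOr-combine [] es i
lookupOr-combine (k ∷ ks) []       zero    = refl
lookupOr-combine (k ∷ ks) []       (suc i) = lookupOr-combine ks [] i
lookupOr-combine (k ∷ ks) (e ∷ es) zero    = refl
lookupOr-combine (k ∷ ks) (e ∷ es) (suc i) = lookupOr-combine ks es i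

pairCounts-replicate : ∀ k x →
  pairCounts (just (replicate k false ++ true ∷ x)) ≡ k ∷ pairCounts (just x)
pairCounts-replicate zero    x = refl
pairCounts-replicate (suc k) x = cong incrementHead (pairCounts-replicate k x)

pairCounts-falses : ∀ k → pairCounts (just (replicate k false)) ≡ suc k ∷ []
pairCounts-falses zero    = refl
pairCounts-falses (suc k) = cong incrementHead (pairCounts-falses k)

lookupOr-pairCounts : ∀ ks i → lookupOr 0 (pairCounts (pairWord ks)) i ≡ lookupOr 0 ks i
lookupOr-pairCounts []       i = refl
lookupOr-pairCounts (k ∷ ks) i with pairWord ks | lookupOr-pairCounts ks
lookupOr-pairCounts (k ∷ ks) i | just x | h rewrite pairCounts-replicate k x with i
... | zero  = refl
... | suc i = h i
lookupOr-pairCounts (suc k ∷ ks) i       | nothing | h rewrite pairCounts-falses k with i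
... | zero  = refl
... | suc i = h i
lookupOr-pairCounts (zero ∷ ks)  zero    | nothing | h = refl
lookupOr-pairCounts (zero ∷ ks)  (suc i) | nothing | h = h i

lookupOr-singleFlags : ∀ es i →
  lookupOr false (singleFlags (singleWord es)) i ≡ lookupOr false es i
lookupOr-singleFlags []       i = refl
lookupOr-singleFlags (e ∷ es) i with singleWord es | lookupOr-singleFlags es
lookupOr-singleFlags (e ∷ es)     zero    | just y  | h = xor-cancel (lowest y) e
lookupOr-singleFlags (e ∷ es)     (suc i) | just y  | h = h i
lookupOr-singleFlags (true ∷ es)  zero    | nothing | h = refl
lookupOr-singleFlags (true ∷ es)  (suc i) | nothing | h = h i
lookupOr-singleFlags (false ∷ es) zero    | nothing | h = refl
lookupOr-singleFlags (false ∷ es) (suc i) | nothing | h = h i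

-- As lists the two may differ in trailing zeros, hence the comparison entry by entry.
lookupOr-decode-encode : ∀ ms i → lookupOr 0 (decode (encode ms)) i ≡ lookupOr 0 ms i
lookupOr-decode-encode ms i = begin
  lookupOr 0 (decode (encode ms)) i
    ≡⟨ lookupOr-combine (pairCounts (pairWord (map (_/ 2) ms))) (singleFlags (singleWord (map odd? ms))) i ⟩
  bit (lookupOr false (singleFlags (singleWord (map odd? ms))) i) +
    lookupOr 0 (pairCounts (pairWord (map (_/ 2) ms))) i * 2
    ≡⟨ cong₂ (λ e k → bit e + k * 2)
         (trans (lookupOr-singleFlags (map odd? ms) i) (lookupOr-map odd? 0 ms i))
         (trans (lookupOr-pairCounts (map (_/ 2) ms) i) (lookupOr-map (_/ 2) 0 ms i)) ⟩
  bit (odd? (lookupOr 0 ms i)) + lookupOr 0 ms i / 2 * 2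
    ≡⟨ bit[odd?]+[m/2]*2 (lookupOr 0 ms i) ⟩
  lookupOr 0 ms i ∎
  where open ≡-Reasoning

-- Pairing index and pairing width in terms of the two words.

pairedSizesOf unpairedOf : List ℕ → List ℕ
pairedSizesOf = sizesWith (2 ≤?_)
unpairedOf    = sizesWith (λ m → m % 2 ≟ 1)

-- An invariant that retains just what the maximum needs: the head is r and bounds the other sizes.
-- Prepending a multiplicity raises the head by one, matching one new `true`.
data PairedSizes : List ℕ → Maybe Word → Set where
  none : PairedSizes [] nothing
  some : ∀ {z zs x} → z ≡ suc (trues x) → All (z ≥_) zs → PairedSizes (z ∷ zs) (just x)

pairedSizes-step : ∀ m {zs p} → PairedSizes zs p →
  PairedSizes (map suc zs ++ onesIf (does (2 ≤? m))) (addPairs (m / 2) p)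
pairedSizes-step m (some {x = x} e h) =
  some (cong suc (trans e (sym (trans (trues-++ (replicate (m / 2) false) (true ∷ x))
                                      (cong (_+ suc (trues x)) (trues-falsesOnly (m / 2)))))))
       (All.++⁺ (All.map⁺ (All.map s≤s h)) (ones (does (2 ≤? m))))
  where
  ones : ∀ {z} b → All (suc z ≥_) (onesIf b)
  ones true  = s≤s z≤n ∷ []
  ones false = []
pairedSizes-step zero          none = none
pairedSizes-step (suc zero)    none = none
pairedSizes-step m@(suc (suc _)) none with m / 2 | m≥n⇒m/n>0 {m} {2} (s≤s (s≤s z≤n))
... | suc k | _ = some (cong suc (sym (trues-falsesOnly k))) []

pairedSizes-spec : ∀ ms → PairedSizes (pairedSizesOf ms) (pairWord (map (_/ 2) ms))
pairedSizes-spec []       = none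
pairedSizes-spec (m ∷ ms) rewrite sizesWith-∷ (2 ≤?_) (λ ()) m ms =
  pairedSizes-step m (pairedSizes-spec ms)

oddLength : List ℕ → Bool
oddLength []       = false
oddLength (_ ∷ us) = not (oddLength us)

oddLength-step : ∀ us b → oddLength (map suc us ++ onesIf b) ≡ oddLength us xor b
oddLength-step []       true  = refl
oddLength-step []       false = refl
oddLength-step (u ∷ us) b rewrite oddLength-step us b with oddLength us
... | true  = not-involutive b
... | false = refl

-- This keeps the truncated subtraction exact when `u` is raised to `suc u`.
alternatingSum≤ : ∀ {u us} → All (u ≥_) us → alternatingSum us ≤ u
alternatingSum≤ []                = z≤n
alternatingSum≤ (_∷_ {v} {vs} h _) = ≤-trans (m∸n≤m v (alternatingSum vs)) h

-- Raising the parts contributes 1 - 1 + 1 - ⋯, and an appended 1 continues this sum by one term. It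
-- amounts to 1 if the new length is odd and to 0 otherwise.
alternatingSum-step : ∀ {us} → AllPairs _≥_ us → ∀ b →
  alternatingSum (map suc us ++ onesIf b) ≡ alternatingSum us + bit (oddLength us xor b)
alternatingSum-step []                  true  = refl
alternatingSum-step []                  false = refl
alternatingSum-step (_∷_ {u} {us} h us↘) b rewrite alternatingSum-step us↘ b
  with oddLength us | b
... | true  | true  = trans (cong (suc u ∸_) (+-identityʳ (alternatingSum us)))
                            (trans (+-∸-assoc 1 (alternatingSum≤ h)) (+-comm 1 _))
... | true  | false = trans (cong (suc u ∸_) (+-comm (alternatingSum us) 1)) (sym (+-identityʳ _))
... | false | true  = trans (cong (suc u ∸_) (+-comm (alternatingSum us) 1)) (sym (+-identityʳ _))
... | false | false = trans (cong (suc u ∸_) (+-identityʳ (alternatingSum us)))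
                            (trans (+-∸-assoc 1 (alternatingSum≤ h)) (+-comm 1 _))

-- There is one letter for each i from 1 to u₁, the last being the implicit `true`, and i adds 1 to
-- the alternating sum exactly when the number of unpaired parts ≥ i is odd. The parity of the
-- length is recorded because the next step needs it.
data Unpaired : List ℕ → Maybe Word → Set where
  none : Unpaired [] nothing
  some : ∀ {u us y} → u ≡ suc (trues y + falses y) → alternatingSum (u ∷ us) ≡ suc (trues y) →
         oddLength (u ∷ us) ≡ lowest y → AllPairs _≥_ (u ∷ us) → Unpaired (u ∷ us) (just y)

-- The alternating sum grows by 1 exactly when the new length is odd, that is, when the new lowest
-- letter is `true`.
unpaired-step : ∀ b {us d} → Unpaired us d → Unpaired (map suc us ++ onesIf b) (addSingle b d)
unpaired-step true  none = some refl refl refl ([] ∷ [])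
unpaired-step false none = none
unpaired-step b (some {u} {us} {y} u≡ alt≡ odd≡ us↘) = some
  (trans (cong suc u≡) (cong suc (sym (length-∷ (lowest y xor b)))))
  (trans (alternatingSum-step us↘ b)
    (trans (cong₂ (λ a c → a + bit (c xor b)) alt≡ odd≡) (cong suc (sym (trues-∷ (lowest y xor b))))))
  (trans (oddLength-step (u ∷ us) b) (cong (_xor b) odd≡))
  (AllPairs.++⁺ (AllPairs.map⁺ (AllPairs.map s≤s us↘)) (single b)
    (All.map⁺ (All.tabulate λ _ → ones b)))
  where
  length-∷ : ∀ c → trues (c ∷ y) + falses (c ∷ y) ≡ suc (trues y + falses y)
  length-∷ true  = refl
  length-∷ false = +-suc (trues y) (falses y)
  trues-∷ : ∀ c → trues (c ∷ y) ≡ trues y + bit c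
  trues-∷ true  = +-comm 1 (trues y)
  trues-∷ false = sym (+-identityʳ (trues y))
  single : ∀ b → AllPairs _≥_ (onesIf b)
  single true  = [] ∷ []
  single false = []
  ones : ∀ {z} b → All (suc z ≥_) (onesIf b)
  ones true  = s≤s z≤n ∷ []
  ones false = []

unpaired-spec : ∀ ms → Unpaired (unpairedOf ms) (singleWord (map odd? ms))
unpaired-spec []       = none
unpaired-spec (m ∷ ms) rewrite sizesWith-∷ (λ m → m % 2 ≟ 1) (λ ()) m ms =
  unpaired-step (odd? m) (unpaired-spec ms)

partition : List ℕ → Partition
partition ms = mkPartition (build ms) (AllPairs⇒Linked (build-decreasing ms)) (build-positive ms)

max-pairedSizes : ∀ {zs p} → PairedSizes zs p → max 0 zs ≡ height p
max-pairedSizes none       = refl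
max-pairedSizes (some e h) = trans (max≈v⁺ (here refl) (≤-refl ∷ h) z≤n) e

alternatingSum-unpaired : ∀ {us d} → Unpaired us d → alternatingSum us ≡ height d
alternatingSum-unpaired none              = refl
alternatingSum-unpaired (some _ alt≡ _ _) = alt≡

residualSpanOf-unpaired : ∀ {us d} → Unpaired us d → residualSpanOf us ≡ wordResidualSpan d
residualSpanOf-unpaired none = refl
residualSpanOf-unpaired (some {y = y} u≡ alt≡ _ _) =
  cong (λ n → 2 * n + 1) (trans (cong₂ _∸_ u≡ alt≡) (m+n∸m≡n (trues y) (falses y)))

pairSpan-partition : ∀ ms → pairSpan (partition ms) ≡ wordPairSpan (pairWord (map (_/ 2) ms))
pairSpan-partition []       = refl
pairSpan-partition (m ∷ ms) =
  trans (sum-sizes-∷ (λ m → 2 * (m / 2)) refl m ms)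
  (trans (cong (_+ 2 * (m / 2)) (pairSpan-partition ms))
         (wordPairSpan-addPairs (m / 2) (pairWord (map (_/ 2) ms))))
  where
  wordPairSpan-addPairs : ∀ k p → wordPairSpan p + 2 * k ≡ wordPairSpan (addPairs k p)
  wordPairSpan-addPairs k (just x) = trans (sym (*-distribˡ-+ 2 (suc (falses x)) k))
    (cong (λ n → 2 * suc n) (trans (+-comm (falses x) k)
      (sym (trans (falses-++ (replicate k false) (true ∷ x)) (cong (_+ falses x) (falses-falsesOnly k))))))
  wordPairSpan-addPairs zero    nothing = refl
  wordPairSpan-addPairs (suc k) nothing = cong (λ n → 2 * suc n) (sym (falses-falsesOnly k))

pairingIndex-partition : ∀ ms → let p , d = encode ms in
  pairingIndex (partition ms) ≡ height p + height d
pairingIndex-partition ms = 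
  cong₂ _+_ (max-pairedSizes (pairedSizes-spec ms)) (alternatingSum-unpaired (unpaired-spec ms))

pairingWidth-partition : ∀ ms → let p , d = encode ms in
  pairingWidth (partition ms) ≡ wordPairSpan p ⊔ wordResidualSpan d
pairingWidth-partition ms = 
  cong₂ _⊔_ (pairSpan-partition ms) (residualSpanOf-unpaired (unpaired-spec ms))

-- Partitions as pairs of words.

multiplicities : Partition → List ℕ
multiplicities π = applyUpTo (multiplicity π ∘ suc) (sum (parts π))

lookupOr-applyUpTo : ∀ {A : Set} d (f : ℕ → A) n → (∀ i → n ≤ i → f i ≡ d) →
  ∀ i → lookupOr d (applyUpTo f n) i ≡ f i
lookupOr-applyUpTo d f zero    h i       = sym (h i z≤n)
lookupOr-applyUpTo d f (suc n) h zero    = refl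
lookupOr-applyUpTo d f (suc n) h (suc i) =
  lookupOr-applyUpTo d (f ∘ suc) n (λ j n≤j → h (suc j) (s≤s n≤j)) i

-- No part exceeds the sum of the parts, so all multiplicities beyond the cut are 0.
lookupOr-multiplicities : ∀ π i → lookupOr 0 (multiplicities π) i ≡ multiplicity π (suc i)
lookupOr-multiplicities π = lookupOr-applyUpTo 0 (multiplicity π ∘ suc) (sum (parts π))
  λ _ sum≤i → sum<i⇒occurrences≡0 (parts π) (s≤s sum≤i)

partition-≡ : ∀ {π ρ} → parts π ≡ parts ρ → π ≡ ρ
partition-≡ refl = refl

toWords : Partition → Maybe Word × Maybe Word
toWords = encode ∘ multiplicities

fromWords : Maybe Word × Maybe Word → Partition
fromWords = partition ∘ decode

toWords-fromWords : ∀ pd → toWords (fromWords pd) ≡ pd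
toWords-fromWords pd = trans
  (encode-cong (multiplicities (fromWords pd)) (decode pd) λ i →
    trans (lookupOr-multiplicities (fromWords pd) i) (occurrences-build (decode pd) i))
  (encode-decode pd)

fromWords-toWords : ∀ π → fromWords (toWords π) ≡ π
fromWords-toWords π@(mkPartition xs xs↘ xs>0) = partition-≡
  (decreasing-unique (build-decreasing ms)
    -- The order and positivity of the parts are irrelevant fields; deciding them anew yields usable
    -- proofs.
    (Linked⇒AllPairs (flip ≤-trans) (recompute (linked? _≥?_ xs) xs↘)) same)
  where
  ms = decode (toWords π)
  same : ∀ i → occurrences i (build ms) ≡ occurrences i xs
  same zero    = trans (occurrences-zero (build-positive ms))
                       (sym (occurrences-zero (recompute (All.all? nonZero? xs) xs>0)))
  same (suc i) = trans (occurrences-build ms i)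
    (trans (lookupOr-decode-encode (multiplicities π) i) (lookupOr-multiplicities π i))

pairingIndex-fromWords : ∀ p d → pairingIndex (fromWords (p , d)) ≡ height p + height d
pairingIndex-fromWords p d = trans (pairingIndex-partition (decode (p , d)))
  (cong (λ (p , d) → height p + height d) (encode-decode (p , d)))

pairingWidth-fromWords : ∀ p d → pairingWidth (fromWords (p , d)) ≡ wordPairSpan p ⊔ wordResidualSpan d
pairingWidth-fromWords p d = trans (pairingWidth-partition (decode (p , d)))
  (cong (λ (p , d) → wordPairSpan p ⊔ wordResidualSpan d) (encode-decode (p , d)))

-- Counting partitions by pairing index and pairing width.

PartitionsWith : ℕ → ℕ → Set
PartitionsWith a b = Σ Partition λ π → pairingIndex π ≡ a × pairingWidth π ≡ b

partitionsWith-≡ : ∀ {a b} {π ρ : PartitionsWith a b} → proj₁ π ≡ proj₁ ρ → π ≡ ρ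
partitionsWith-≡ {π = π , i , w} {.π , i′ , w′} refl
  rewrite ≡-irrelevant i i′ | ≡-irrelevant w w′ = refl

words↔partitions : ∀ i j → WordsWith i j ↔ PartitionsWith (suc i) (suc j)
words↔partitions i j = mk↔ₛ′ to from to∘from from∘to
  where
  to : WordsWith i j → PartitionsWith (suc i) (suc j)
  to (w , t , f) = fromWords (p , d) ,
    trans (pairingIndex-fromWords p d)
      (trans (sym (trues-shape (shape p d) ne)) (cong suc (trans (cong trues (merge-unmerge w)) t))) ,
    trans (pairingWidth-fromWords p d)
      (trans (sym (falses-shape (shape p d) ne)) (cong suc (trans (cong falses (merge-unmerge w)) f)))
    where
    p = proj₁ (unmerge w)
    d = proj₂ (unmerge w)
    ne = unmerge-nonEmpty w

  word : Partition → Word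
  word π = let p , d = toWords π in merge p d

  index≡ : ∀ π → let p , d = toWords π in pairingIndex π ≡ height p + height d
  index≡ π = trans (cong pairingIndex (sym (fromWords-toWords π)))
    (pairingIndex-fromWords (proj₁ (toWords π)) (proj₂ (toWords π)))

  width≡ : ∀ π → let p , d = toWords π in pairingWidth π ≡ wordPairSpan p ⊔ wordResidualSpan d
  width≡ π = trans (cong pairingWidth (sym (fromWords-toWords π)))
    (pairingWidth-fromWords (proj₁ (toWords π)) (proj₂ (toWords π)))

  nonEmpty : ∀ π → pairingIndex π ≡ suc i → NonEmpty (toWords π)
  -- A positive pairing index rules out the empty partition.
  nonEmpty π idx e = 0≢1+n (trans (sym e) (trans (sym (index≡ π)) idx))

  from : PartitionsWith (suc i) (suc j) → WordsWith i j
  from (π , idx , wid) = word π ,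
    suc-injective (trans (trues-shape σ (nonEmpty π idx)) (trans (sym (index≡ π)) idx)) ,
    suc-injective (trans (falses-shape σ (nonEmpty π idx)) (trans (sym (width≡ π)) wid))
    where σ = shape (proj₁ (toWords π)) (proj₂ (toWords π))

  to∘from : ∀ π → to (from π) ≡ π
  to∘from (π , idx , wid) = partitionsWith-≡
    (trans (cong fromWords (unmerge-shape (shape (proj₁ (toWords π)) (proj₂ (toWords π))) (nonEmpty π idx)))
           (fromWords-toWords π))

  from∘to : ∀ w → from (to w) ≡ w
  from∘to (w , _ , _) = wordsWith-≡
    (trans (cong (λ (p , d) → merge p d) (toWords-fromWords (unmerge w))) (merge-unmerge w))

corollary2p7 : (p : ℕ) (p-prime : Prime p) (a b : ℕ) → 1 ≤ a → 1 ≤ b →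
    ∃[ N ] (TotalNumber a b N × Valuation p N (numberOfCarries p {{prime⇒nonZero p-prime}} (a ∸ 1) (b ∸ 1)))
corollary2p7 p p-prime (suc i) (suc j) _ _ =
  (i + j) C i , ↔-trans (wordsWith-count i j) (words↔partitions i j) , Kummer.kummer p p-prime i j
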